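{- Let $\mathbb{0}=\{x\in\omega^\omega : x(n)=0 \text{ for all but finitely many } n\}$. Then every maximal chain of $(\omega^\omega\setminus\mathbb{0},\le^*)$ has size at least $\mathfrak{c}$; consequently $\mathfrak{mc}(\omega^\omega\setminus\mathbb{0},\le^*)=\mathfrak{c}$.
   Context: For $x,y\in\omega^\omega$, $x\le^* y$ means $x(n)\le y(n)$ for all but finitely many $n$. For a poset (or preorder) $(P,\le)$, a chain is a subset whose elements are pairwise comparable, and $\mathfrak{mc}(P)$ is the minimal cardinality of a maximal (with respect to inclusion) chain of $P$. $\mathfrak{c}=2^{\aleph_0}$. -}

module Defs where

open import Data.Bool.Base using (Bool)
open import Data.List.Base using (List; []; _++_)
open import Data.List.Membership.Propositional.Properties using (∈-++⁺ˡ; ∈-++⁺ʳ)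
open import Data.Nat.Base using (ℕ; _≤_)
open import Data.Nat.Properties using (≤-refl; ≤-trans)
open import Data.Product.Base using (Σ; ∃-syntax; _×_; _,_; proj₁)
open import Data.Sum.Base using (_⊎_)
open import Function.Base using (_∘_)
open import Function.Bundles using (Injection; Bijection)
open import Level using (Level; 0ℓ; _⊔_)
open import Relation.Binary.Bundles using (Preorder; Setoid)
open import Relation.Binary.PropositionalEquality using (_≡_; refl; setoid; isEquivalence)
open import Relation.Unary using (Pred; _∈_; _∉_; _⊆_)
import Data.List.Membership.Propositional as List
import Relation.Binary.Construct.On as On

private
  variable
    a b ℓ₁ ℓ₂ : Level

-- A set, for the purpose of measuring its size, is a setoid; |A| ≤ |B| and
-- |A| = |B| have their usual meaning.

infix 4 _≼_ _≅_

_≼_ : Setoid a ℓ₁ → Setoid b ℓ₂ → Set (a ⊔ b ⊔ ℓ₁ ⊔ ℓ₂)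
A ≼ B = Injection A B

_≅_ : Setoid a ℓ₁ → Setoid b ℓ₂ → Set (a ⊔ b ⊔ ℓ₁ ⊔ ℓ₂)
A ≅ B = Bijection A B

-- 2^ℕ, a set of cardinality 𝔠.
𝔠 : Setoid 0ℓ 0ℓ
𝔠 = setoid (ℕ → Bool)

module _ (P : Preorder 0ℓ 0ℓ 0ℓ) where
  open Preorder P using (Carrier; _≲_; module Eq)

  IsChain : Pred Carrier 0ℓ → Set
  IsChain C = ∀ {x y} → x ∈ C → y ∈ C → x ≲ y ⊎ y ≲ x

  IsMaximalChain : Pred Carrier 0ℓ → Set₁
  IsMaximalChain C = IsChain C × (∀ (D : Pred Carrier 0ℓ) → IsChain D → C ⊆ D → D ⊆ C)

  -- Elements of a subset are compared by the equality _≈_ of P, ignoring the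
  -- membership proofs.  This is not the equivalence "x ≲ y and y ≲ x".
  ⟪_⟫ : Pred Carrier 0ℓ → Setoid 0ℓ 0ℓ
  ⟪ C ⟫ = On.setoid {B = Σ Carrier C} Eq.setoid proj₁

  -- 𝔪𝔠(P) = |K|, i.e. |K| is the least element of the class of cardinalities
  -- of maximal chains of P.
  𝔪𝔠≡ : Setoid 0ℓ 0ℓ → Set₁
  𝔪𝔠≡ K = (∃[ C ] IsMaximalChain C × ⟪ C ⟫ ≅ K)
        × (∀ C → IsMaximalChain C → K ≼ ⟪ C ⟫)

ω^ω : Set
ω^ω = ℕ → ℕ

AllButFinitelyMany : Pred ℕ 0ℓ → Set
AllButFinitelyMany Q = ∃[ exceptions ] (∀ n → n List.∉ exceptions → Q n)

infix 4 _≤*_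

_≤*_ : ω^ω → ω^ω → Set
x ≤* y = AllButFinitelyMany (λ n → x n ≤ y n)

𝟘 : Pred ω^ω 0ℓ
𝟘 x = AllButFinitelyMany (λ n → x n ≡ 0)

≤*-preorder : Preorder 0ℓ 0ℓ 0ℓ
≤*-preorder = record
  { Carrier    = ω^ω
  ; _≈_        = _≡_
  ; _≲_        = _≤*_
  ; isPreorder = record
    { isEquivalence = isEquivalence
    ; reflexive     = λ { refl → [] , λ _ _ → ≤-refl }
    ; trans         = λ { (L , p) (M , q) → L ++ M , λ n n∉ →
                          ≤-trans (p n (n∉ ∘ ∈-++⁺ˡ)) (q n (n∉ ∘ ∈-++⁺ʳ L)) }
    }
  }

-- Two elements are equal when their underlying functions are.
ω^ω∖𝟘 : Preorder 0ℓ 0ℓ 0ℓ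
ω^ω∖𝟘 = On.preorder ≤*-preorder (proj₁ {B = λ x → x ∉ 𝟘})

{-# OPTIONS --safe #-}

-- A maximal chain C realises every cut of itself that is realised in the whole preorder (`fill`).
-- Since ≤* is dense, has no maximal element, and admits no (ω,ω)-gaps, C contains a binary tree of
-- nested intervals in which siblings are disjoint, and every branch of the tree has a member of C in
-- all of its intervals.  Distinct branches give distinct members, so 2^ℕ embeds in C.  Conversely
-- ω^ω embeds in 2^ℕ, and maximal chains exist by Hausdorff's principle.
module Submission where

open import Defs
open import Axiom.ExcludedMiddle using (ExcludedMiddle)
open import Axiom.Extensionality.Propositional using (Extensionality)
open import Data.Bool.Base using (Bool; true; false; not; T; if_then_else_)
open import Data.Bool.Properties using (¬-not) renaming (_≟_ to _≟ᵇ_)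
open import Data.Empty using (⊥-elim)
open import Data.List.Base using ([]; _++_; upTo)
open import Data.List.Extrema.Nat using (max; xs≤max)
open import Data.List.Membership.Propositional.Properties using (∈-++⁺ˡ; ∈-++⁺ʳ; ∈-upTo⁺)
import Data.List.Relation.Unary.All as All
open import Data.Nat.Base hiding (parity)
open import Data.Nat.Properties
open import Data.Product.Base using (Σ; ∃-syntax; _×_; _,_; proj₁; proj₂)
open import Data.Sum.Base using (_⊎_; inj₁; inj₂; swap; [_,_]′)
open import Function.Base using (_∘_; id; case_of_)
open import Function.Bundles using (Injection)
open import Level using (Level; 0ℓ)
open import Relation.Binary.Bundles using (Preorder; Setoid)
open import Relation.Binary.PropositionalEquality
  using (_≡_; refl; sym; trans; cong; cong₂; cong-app; subst)
open import Relation.Nullary using (¬_; Dec; yes; no)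
open import Relation.Nullary.Decidable using (isYes; toWitness; fromWitness)
open import Relation.Unary using (Pred; _∈_; _∉_; _⊆_; _∪_; ｛_｝)

private
  variable
    a b ℓ₁ ℓ₂ : Level

-- Hausdorff's maximal principle

-- Subsets are Bool-valued so that, by extensionality, the chosen extension of a subset depends only
-- on its members, and so that the tower of all iterated extensions lives in Set.
module Hausdorff (em : ExcludedMiddle 0ℓ) (ext : Extensionality 0ℓ 0ℓ) (P : Preorder 0ℓ 0ℓ 0ℓ) where
  open Preorder P using (Carrier)

  Subset : Set
  Subset = Carrier → Bool

  ⟨_⟩ : Subset → Pred Carrier 0ℓ
  ⟨ A ⟩ x = T (A x)

  ⟦_⟧ : Pred Carrier 0ℓ → Subset
  ⟦ Q ⟧ x = isYes (em {Q x})

  T-ext : ∀ {s t} → (T s → T t) → (T t → T s) → s ≡ t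
  T-ext {false} {false} _ _ = refl
  T-ext {false} {true}  _ g = ⊥-elim (g _)
  T-ext {true}  {false} f _ = ⊥-elim (f _)
  T-ext {true}  {true}  _ _ = refl

  ⊆-antisym : ∀ {A B} → ⟨ A ⟩ ⊆ ⟨ B ⟩ → ⟨ B ⟩ ⊆ ⟨ A ⟩ → A ≡ B
  ⊆-antisym A⊆B B⊆A = ext λ _ → T-ext A⊆B B⊆A

  Extension : Subset → Set
  Extension A = ∃[ x ] x ∉ ⟨ A ⟩ × IsChain P (⟨ A ⟩ ∪ ｛ x ｝)

  extendBy : ∀ A → Dec (Extension A) → Subset
  extendBy A (yes (x , _)) = ⟦ ⟨ A ⟩ ∪ ｛ x ｝ ⟧
  extendBy A (no _)        = A

  extend : Subset → Subset
  extend A = extendBy A em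

  ⊆-extend : ∀ A → ⟨ A ⟩ ⊆ ⟨ extend A ⟩
  ⊆-extend A x∈A with em {Extension A}
  ... | yes _ = fromWitness (inj₁ x∈A)
  ... | no  _ = x∈A

  extend-chain : ∀ A → IsChain P ⟨ A ⟩ → IsChain P ⟨ extend A ⟩
  extend-chain A chain x∈ y∈ with em {Extension A}
  ... | yes (_ , _ , chain⁺) = chain⁺ (toWitness x∈) (toWitness y∈)
  ... | no  _                = chain x∈ y∈

  extend⊆⇒¬Extension : ∀ A → ⟨ extend A ⟩ ⊆ ⟨ A ⟩ → ¬ Extension A
  extend⊆⇒¬Extension A ⊆A e with em {Extension A}
  ... | yes (x , x∉A , _) = x∉A (⊆A (fromWitness (inj₂ refl)))
  ... | no ¬e             = ¬e e

  ⋃ : (Subset → Bool) → Subset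
  ⋃ F = ⟦ (λ x → ∃[ A ] T (F A) × x ∈ ⟨ A ⟩) ⟧

  -- The subsets generated by extension and unions; the empty set enters as the union of the empty
  -- family.
  data Tower : Subset → Set where
    extendᵗ : ∀ {A} → Tower A → Tower (extend A)
    ⋃ᵗ      : ∀ F → (∀ {A} → T (F A) → Tower A) → Tower (⋃ F)

  -- Double induction on the tower: the successor step may use R in both directions.
  Tower-ind₂ : (R : Subset → Subset → Set) →
               (∀ {A B} → R A B → R B A → R (extend A) B) →
               (∀ {F B} → (∀ {A} → T (F A) → R A B) → R (⋃ F) B) →
               ∀ {A B} → Tower A → Tower B → R A B
  Tower-ind₂ R step lim = go
    where
    go : ∀ {A B} → Tower A → Tower B → R A B
    go (⋃ᵗ F ts)           u = lim λ A∈F → go (ts A∈F) u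
    go {B = B} (extendᵗ {A} t) u = step (go t u) (flip u)
      where
      -- Inner induction on the second argument with `A` fixed; `go t` supplies the opposite
      -- direction at each stage.
      flip : ∀ {B} → Tower B → R B A
      flip (extendᵗ v) = step (flip v) (go t v)
      flip (⋃ᵗ F vs)   = lim λ B∈F → flip (vs B∈F)

  -- The alternative `extend B ⊆ A`, stronger than `B ⊆ A`, carries the successor step: if `A` and
  -- `B` include each other they are equal, hence so are their extensions.
  Tower-linear : ∀ {A B} → Tower A → Tower B → ⟨ A ⟩ ⊆ ⟨ B ⟩ ⊎ ⟨ extend B ⟩ ⊆ ⟨ A ⟩
  Tower-linear = Tower-ind₂ R step lim
    where
    R : Subset → Subset → Set
    R A B = ⟨ A ⟩ ⊆ ⟨ B ⟩ ⊎ ⟨ extend B ⟩ ⊆ ⟨ A ⟩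

    step : ∀ {A B} → R A B → R B A → R (extend A) B
    step         _           (inj₂ eA⊆B) = inj₁ eA⊆B
    step {A}     (inj₂ eB⊆A) (inj₁ _)    = inj₂ (⊆-extend A ∘ eB⊆A)
    step {A} {B} (inj₁ A⊆B)  (inj₁ B⊆A)  =
      inj₂ (subst (λ X → ⟨ extend B ⟩ ⊆ ⟨ extend X ⟩) (⊆-antisym {B} {A} B⊆A A⊆B) id)

    lim : ∀ {F B} → (∀ {A} → T (F A) → R A B) → R (⋃ F) B
    lim {F} {B} r with em {∃[ A ] T (F A) × ⟨ extend B ⟩ ⊆ ⟨ A ⟩}
    ... | yes (A , A∈F , eB⊆A) = inj₂ λ x∈ → fromWitness (A , A∈F , eB⊆A x∈)
    ... | no none = inj₁ λ x∈ → member (toWitness x∈)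
      where
      member : ∀ {x} → ∃[ A ] T (F A) × x ∈ ⟨ A ⟩ → x ∈ ⟨ B ⟩
      member (A , A∈F , x∈A) with r A∈F
      ... | inj₁ A⊆B  = A⊆B x∈A
      ... | inj₂ eB⊆A = ⊥-elim (none (A , A∈F , eB⊆A))

  Tower-chain : ∀ {A} → Tower A → IsChain P ⟨ A ⟩
  Tower-chain (extendᵗ {A} t) = extend-chain A (Tower-chain t)
  Tower-chain (⋃ᵗ F ts) x∈ y∈ with toWitness x∈ | toWitness y∈
  ... | A , A∈F , x∈A | B , B∈F , y∈B with Tower-linear (ts A∈F) (ts B∈F)
  ...   | inj₁ A⊆B  = Tower-chain (ts B∈F) (A⊆B x∈A) y∈B
  ...   | inj₂ eB⊆A = Tower-chain (ts A∈F) x∈A (eB⊆A (⊆-extend B y∈B))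

  isTower : Subset → Bool
  isTower A = isYes (em {Tower A})

  top : Subset
  top = ⋃ isTower

  top-tower : Tower top
  top-tower = ⋃ᵗ isTower toWitness

  -- `extend top` is again in the tower, so the union `top` already contains it, whereas a genuine
  -- extension would add a new point.
  ¬Extension-top : ¬ Extension top
  ¬Extension-top = extend⊆⇒¬Extension top λ x∈ →
    fromWitness (extend top , fromWitness (extendᵗ top-tower) , x∈)

  hausdorff : ∃[ C ] IsMaximalChain P C
  hausdorff = ⟨ top ⟩ , Tower-chain top-tower , λ D chain top⊆D {x} x∈D →
    case em {x ∈ ⟨ top ⟩} of λ where
      (yes x∈top) → x∈top
      (no  x∉top) → ⊥-elim (¬Extension-top (x , x∉top , λ p q →
        chain ([ top⊆D , (λ { refl → x∈D }) ]′ p) ([ top⊆D , (λ { refl → x∈D }) ]′ q)))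

-- The Cantor–Bernstein theorem

module CantorBernstein
  (em : ∀ {ℓ} → ExcludedMiddle ℓ)
  {A : Setoid a ℓ₁} {B : Setoid b ℓ₂} (A≼B : A ≼ B) (B≼A : B ≼ A) where

  private
    module A = Setoid A
    module B = Setoid B
    module f = Injection A≼B
    module g = Injection B≼A

  Image : A.Carrier → Set _
  Image x = ∃[ y ] g.to y A.≈ x

  -- The points reached from outside the image of `g` by iterating `g ∘ f`. The bijection is `f` on
  -- these and the inverse of `g` on the rest.
  data FromOutside : A.Carrier → Set (a Level.⊔ b Level.⊔ ℓ₁) where
    start : ∀ {x} → ¬ Image x → FromOutside x
    step  : ∀ {x y} → FromOutside x → g.to (f.to x) A.≈ y → FromOutside y

  FromOutside-resp : ∀ {x y} → x A.≈ y → FromOutside x → FromOutside y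
  FromOutside-resp x≈y (start x∉)  = start λ (z , e) → x∉ (z , A.trans e (A.sym x≈y))
  FromOutside-resp x≈y (step o e)  = step o (A.trans e x≈y)

  image : ∀ {x} → ¬ FromOutside x → Image x
  image {x} ¬o with em {P = Image x}
  ... | yes im = im
  ... | no ¬im = ⊥-elim (¬o (start ¬im))

  toBy : ∀ x → Dec (FromOutside x) → B.Carrier
  toBy x (yes _) = f.to x
  toBy x (no ¬o) = proj₁ (image ¬o)

  to : A.Carrier → B.Carrier
  to x = toBy x em

  toBy-cong : ∀ {x y} d e → x A.≈ y → toBy x d B.≈ toBy y e
  toBy-cong (yes _) (yes _)  x≈y = f.cong x≈y
  toBy-cong (yes o) (no ¬o)  x≈y = ⊥-elim (¬o (FromOutside-resp x≈y o))
  toBy-cong (no ¬o) (yes o)  x≈y = ⊥-elim (¬o (FromOutside-resp (A.sym x≈y) o))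
  toBy-cong (no ¬o) (no ¬o′) x≈y =
    g.injective (A.trans (proj₂ (image ¬o)) (A.trans x≈y (A.sym (proj₂ (image ¬o′)))))

  -- In the mixed cases a common value would make one point the image under `g ∘ f` of a point in
  -- `FromOutside`, putting it there too.
  toBy-injective : ∀ {x y} d e → toBy x d B.≈ toBy y e → x A.≈ y
  toBy-injective (yes _) (yes _)  eq = f.injective eq
  toBy-injective (yes o) (no ¬o)  eq = ⊥-elim (¬o (step o (A.trans (g.cong eq) (proj₂ (image ¬o)))))
  toBy-injective (no ¬o) (yes o)  eq =
    ⊥-elim (¬o (step o (A.trans (g.cong (B.sym eq)) (proj₂ (image ¬o)))))
  toBy-injective (no ¬o) (no ¬o′) eq =
    A.trans (A.sym (proj₂ (image ¬o))) (A.trans (g.cong eq) (proj₂ (image ¬o′)))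

  preimage : ∀ y → ∃[ x ] (∀ {z} → z A.≈ x → to z B.≈ y)
  preimage y with em {P = FromOutside (g.to y)}
  ... | yes (start ∉im) = ⊥-elim (∉im (y , A.refl))
  ... | yes (step {x} o e) = x , λ {z} z≈x → B.trans (toBy-cong em (yes o) z≈x) (g.injective e)
  ... | no ¬o = g.to y , λ z≈ → B.trans (toBy-cong em (no ¬o) z≈) (g.injective (proj₂ (image ¬o)))

  bijection : A ≅ B
  bijection = record
    { to        = to
    ; cong      = toBy-cong em em
    ; bijective = toBy-injective em em , preimage
    }

-- Coding sequences of natural numbers by subsets of ℕ

-- Walks through each antidiagonal, then jumps to the start of the following one.
next : ℕ × ℕ → ℕ × ℕ
next (zero  , n) = suc n , zero
next (suc m , n) = m , suc n

unpair : ℕ → ℕ × ℕ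
unpair zero    = zero , zero
unpair (suc k) = next (unpair k)

unpair-surjective : ∀ m n → ∃[ k ] unpair k ≡ (m , n)
unpair-surjective m n = go (m + n) m n refl
  where
  go : ∀ s m n → m + n ≡ s → ∃[ k ] unpair k ≡ (m , n)
  go s zero zero _ = zero , refl
  go (suc s) (suc m) zero eq =
    let k , e = go s zero m (suc-injective (trans (cong suc (sym (+-identityʳ m))) eq))
    in suc k , cong next e
  go s m (suc n) eq =
    let k , e = go s (suc m) n (trans (sym (+-suc m n)) eq)
    in suc k , cong next e

graphAt : ω^ω → ℕ × ℕ → Bool
graphAt x (m , n) = x m ≡ᵇ n

graph : ω^ω → ℕ → Bool
graph x = graphAt x ∘ unpair

graph-injective : Extensionality 0ℓ 0ℓ → ∀ {x y} → graph x ≡ graph y → x ≡ y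
graph-injective ext {x} {y} eq = ext λ n →
  let k , e = unpair-surjective n (x n)
      at : graphAt x (n , x n) ≡ graphAt y (n , x n)
      at = subst (λ p → graphAt x p ≡ graphAt y p) e (cong-app eq k)
  in sym (≡ᵇ⇒≡ (y n) (x n) (subst T at (≡⇒≡ᵇ (x n) (x n) refl)))

-- Filling cuts in maximal chains

-- `point` and `above` serve the root of the tree, `between` the splitting of nodes, `squeeze` the
-- limits of branches.
record Rich (P : Preorder 0ℓ 0ℓ 0ℓ) : Set where
  open Preorder P using (Carrier; _≲_)
  field
    point   : Carrier
    above   : ∀ x → ∃[ y ] x ≲ y × ¬ y ≲ x
    between : ∀ {x y} → x ≲ y → ¬ y ≲ x → ∃[ z ] (x ≲ z × ¬ z ≲ x) × (z ≲ y × ¬ y ≲ z)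
    squeeze : ∀ (l u : ℕ → Carrier) → (∀ i j → l i ≲ u j) →
              ∃[ x ] (∀ i → l i ≲ x) × (∀ j → x ≲ u j)

module _ (em : ExcludedMiddle 0ℓ) (P : Preorder 0ℓ 0ℓ 0ℓ) where
  open Preorder P using (Carrier; _≲_) renaming (refl to ≲-refl; trans to ≲-trans)

  module _ {C : Pred Carrier 0ℓ} (maximal : IsMaximalChain P C) where

    comparable⇒∈ : ∀ {x} → (∀ {c} → c ∈ C → c ≲ x ⊎ x ≲ c) → x ∈ C
    comparable⇒∈ {x} cmp = proj₂ maximal (C ∪ ｛ x ｝) chain inj₁ (inj₂ refl)
      where
      chain : IsChain P (C ∪ ｛ x ｝)
      chain (inj₁ c∈)   (inj₁ d∈)   = proj₁ maximal c∈ d∈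
      chain (inj₁ c∈)   (inj₂ refl) = cmp c∈
      chain (inj₂ refl) (inj₁ d∈)   = swap (cmp d∈)
      chain (inj₂ refl) (inj₂ refl) = inj₁ ≲-refl

    -- If some `c` in the chain is incomparable with `x`, that `c` lies in the same cut: a member of
    -- `C` below `x` cannot be above `c`, and dually. Otherwise `x` itself belongs to `C`. The
    -- implications preserve strict inequalities.
    fill : ∀ x → ∃[ c ] c ∈ C
         × (∀ {l} → l ∈ C → l ≲ x → l ≲ c × (c ≲ l → x ≲ l))
         × (∀ {u} → u ∈ C → x ≲ u → c ≲ u × (u ≲ c → u ≲ x))
    fill x with em {∃[ c ] c ∈ C × ¬ (c ≲ x ⊎ x ≲ c)}
    ... | yes (c , c∈ , c∥x) = c , c∈
        , (λ l∈ l≲x → [ id , (λ c≲l → ⊥-elim (c∥x (inj₁ (≲-trans c≲l l≲x)))) ]′ (proj₁ maximal l∈ c∈)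
                    , λ c≲l → ⊥-elim (c∥x (inj₁ (≲-trans c≲l l≲x))))
        , (λ u∈ x≲u → [ id , (λ u≲c → ⊥-elim (c∥x (inj₂ (≲-trans x≲u u≲c)))) ]′ (proj₁ maximal c∈ u∈)
                    , λ u≲c → ⊥-elim (c∥x (inj₂ (≲-trans x≲u u≲c))))
    ... | no none = x , comparable⇒∈ cmp , (λ _ l≲x → l≲x , id) , (λ _ x≲u → x≲u , id)
      where
      cmp : ∀ {c} → c ∈ C → c ≲ x ⊎ x ≲ c
      cmp {c} c∈ with em {c ≲ x ⊎ x ≲ c}
      ... | yes p = p
      ... | no ¬p = ⊥-elim (none (c , c∈ , ¬p))

  -- The binary tree of intervals in a maximal chain

  module Tree (rich : Rich P) {C : Pred Carrier 0ℓ} (maximal : IsMaximalChain P C) where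
    open Rich rich

    record Interval : Set where
      constructor interval
      field
        {lo hi} : Carrier
        lo∈     : lo ∈ C
        hi∈     : hi ∈ C
        lo≲hi   : lo ≲ hi
        hi≴lo   : ¬ hi ≲ lo
    open Interval

    between∈ : ∀ {x y} → x ∈ C → y ∈ C → x ≲ y → ¬ y ≲ x →
               ∃[ z ] z ∈ C × (x ≲ z × ¬ z ≲ x) × (z ≲ y × ¬ y ≲ z)
    between∈ x∈ y∈ x≲y y≴x =
      let z , (x≲z , z≴x) , (z≲y , y≴z) = between x≲y y≴x
          c , c∈ , low , high = fill maximal z
      in c , c∈ , (proj₁ (low x∈ x≲z) , λ c≲x → z≴x (proj₂ (low x∈ x≲z) c≲x))
                , (proj₁ (high y∈ z≲y) , λ y≲c → y≴z (proj₂ (high y∈ z≲y) y≲c))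

    root : Interval
    root =
      let x , x∈ , _ = fill maximal point
          y , x≲y , y≴x = above x
          c , c∈ , low , _ = fill maximal y
      in interval x∈ c∈ (proj₁ (low x∈ x≲y)) (λ c≲x → y≴x (proj₂ (low x∈ x≲y) c≲x))

    record _⊑_ (I J : Interval) : Set where
      constructor nested
      field
        lo≥ : lo J ≲ lo I
        hi≤ : hi I ≲ hi J
    open _⊑_

    ⊑-refl : ∀ {I} → I ⊑ I
    ⊑-refl = nested ≲-refl ≲-refl

    ⊑-trans : ∀ {I J K} → I ⊑ J → J ⊑ K → I ⊑ K
    ⊑-trans (nested p q) (nested p′ q′) = nested (≲-trans p′ p) (≲-trans q q′)

    split : ∀ I → Σ (Interval × Interval) λ (L , R) → L ⊑ I × R ⊑ I × ¬ lo R ≲ hi L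
    split I =
      -- Two cut points `m < n` are taken, since a single one would be an endpoint of both children.
      let m , m∈ , (l≲m , m≴l) , (m≲h , h≴m) = between∈ (lo∈ I) (hi∈ I) (lo≲hi I) (hi≴lo I)
          n , n∈ , (m≲n , n≴m) , (n≲h , h≴n) = between∈ m∈ (hi∈ I) m≲h h≴m
      in (interval (lo∈ I) m∈ l≲m m≴l , interval n∈ (hi∈ I) n≲h h≴n)
       , nested ≲-refl m≲h , nested (≲-trans l≲m m≲n) ≲-refl , n≴m

    child : Bool → Interval → Interval
    child false I = proj₁ (proj₁ (split I))
    child true  I = proj₂ (proj₁ (split I))

    child-⊑ : ∀ s I → child s I ⊑ I
    child-⊑ false I = proj₁ (proj₂ (split I))
    child-⊑ true  I = proj₁ (proj₂ (proj₂ (split I)))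

    Within : Carrier → Interval → Set
    Within c I = lo I ≲ c × c ≲ hi I

    child-disjoint : ∀ {c} I s t → Within c (child s I) → Within c (child t I) → s ≡ t
    child-disjoint I false false _ _ = refl
    child-disjoint I true  true  _ _ = refl
    child-disjoint I false true  (_ , c≲) (≲c , _) =
      ⊥-elim (proj₂ (proj₂ (proj₂ (split I))) (≲-trans ≲c c≲))
    child-disjoint I true  false (≲c , _) (_ , c≲) =
      ⊥-elim (proj₂ (proj₂ (proj₂ (split I))) (≲-trans ≲c c≲))

    branch : (ℕ → Bool) → ℕ → Interval
    branch f zero    = root
    branch f (suc n) = child (f n) (branch f n)

    branch-⊑ : ∀ f {m n} → m ≤′ n → branch f n ⊑ branch f m
    branch-⊑ f ≤′-refl                 = ⊑-refl
    branch-⊑ f (≤′-step {n = n} m≤n) = ⊑-trans (child-⊑ (f n) (branch f n)) (branch-⊑ f m≤n)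

    branch-lo≲hi : ∀ f i j → lo (branch f i) ≲ hi (branch f j)
    branch-lo≲hi f i j with ≤-total i j
    ... | inj₁ i≤j = ≲-trans (lo≥ (branch-⊑ f (≤⇒≤′ i≤j))) (lo≲hi (branch f j))
    ... | inj₂ j≤i = ≲-trans (lo≲hi (branch f i)) (hi≤ (branch-⊑ f (≤⇒≤′ j≤i)))

    -- The squeezed point may lie outside `C`; as all endpoints are in `C`, `fill` moves it into `C`
    -- without leaving any interval.
    limit : ∀ f → ∃[ c ] c ∈ C × (∀ n → Within c (branch f n))
    limit f =
      let x , ≲x , x≲ = squeeze (lo ∘ branch f) (hi ∘ branch f) (branch-lo≲hi f)
          c , c∈ , low , high = fill maximal x
      in c , c∈ , λ n → proj₁ (low (lo∈ (branch f n)) (≲x n)) , proj₁ (high (hi∈ (branch f n)) (x≲ n))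

    -- By induction the two branches share their node at level `n`; both next children contain `c`,
    -- so disjointness of siblings forces the same bit.
    branches-agree : ∀ {c} f g → (∀ n → Within c (branch f n)) → (∀ n → Within c (branch g n)) →
                     ∀ n → f n ≡ g n
    branches-agree {c} f g inF inG n = agree n (same n)
      where
      agree : ∀ n → branch f n ≡ branch g n → f n ≡ g n
      agree n eq = child-disjoint (branch f n) (f n) (g n) (inF (suc n))
        (subst (Within c ∘ child (g n)) (sym eq) (inG (suc n)))

      same : ∀ n → branch f n ≡ branch g n
      same zero    = refl
      same (suc n) = cong₂ child (agree n (same n)) (same n)

-- Density and interpolation in (ω^ω, ≤*)

private
  variable
    Q R : Pred ℕ 0ℓ

map* : Q ⊆ R → AllButFinitelyMany Q → AllButFinitelyMany R
map* Q⊆R (L , q) = L , λ n n∉ → Q⊆R (q n n∉)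

zip* : AllButFinitelyMany Q → AllButFinitelyMany R → AllButFinitelyMany (λ n → Q n × R n)
zip* (L , q) (M , r) = L ++ M , λ n n∉ → q n (n∉ ∘ ∈-++⁺ˡ) , r n (n∉ ∘ ∈-++⁺ʳ L)

all≤* : ∀ {Q : ℕ → Pred ℕ 0ℓ} i → (∀ j → j ≤ i → AllButFinitelyMany (Q j)) →
        AllButFinitelyMany (λ n → ∀ j → j ≤ i → Q j n)
all≤* zero    q = map* (λ { q₀ .zero z≤n → q₀ }) (q zero z≤n)
all≤* {Q} (suc i) q = map* combine (zip* (q (suc i) ≤-refl) (all≤* {Q} i λ j j≤i → q j (m≤n⇒m≤1+n j≤i)))
  where
  combine : ∀ {n} → Q (suc i) n × (∀ j → j ≤ i → Q j n) → ∀ j → j ≤ suc i → Q j n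
  combine (qₛ , qs) j j≤ with m≤n⇒m<n∨m≡n j≤
  ... | inj₁ j<  = qs j (s≤s⁻¹ j<)
  ... | inj₂ refl = qₛ

from* : ∀ N → (∀ n → N ≤ n → Q n) → AllButFinitelyMany Q
from* N q = upTo N , λ n n∉ → q n (≮⇒≥ (n∉ ∘ ∈-upTo⁺))

threshold : AllButFinitelyMany Q → ∃[ N ] (∀ n → N ≤ n → Q n)
-- One past the largest exception; the default 0 covers the empty list.
threshold (L , q) = suc (max 0 L) , λ n N≤n → q n λ n∈L →
  <⇒≱ N≤n (All.lookup (xs≤max 0 L) n∈L)

≰*⇒infinite : ExcludedMiddle 0ℓ → ∀ {x y} → ¬ y ≤* x → ∀ N → ∃[ n ] N ≤ n × x n < y n
≰*⇒infinite em {x} {y} y≰x N with em {∃[ n ] N ≤ n × x n < y n}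
... | yes p = p
... | no ¬p = ⊥-elim (y≰x (from* N λ n N≤n → ≮⇒≥ λ x<y → ¬p (n , N≤n , x<y)))

infinite⇒≰* : ∀ {x y} → (∀ N → ∃[ n ] N ≤ n × x n < y n) → ¬ y ≤* x
infinite⇒≰* inf y≤x =
  let N , y≤ = threshold y≤x
      n , N≤n , x<y = inf N
  in <⇒≱ x<y (y≤ n N≤n)

-- The parity of the number of k < n satisfying d splits an infinite set d into two infinite halves.
parity : (ℕ → Bool) → ℕ → Bool
parity d zero    = false
parity d (suc n) = if d n then not (parity d n) else parity d n

-- If the parity is wrong at a member of `d`, it flips right after it and then stays correct up to
-- the next member, which is a hit.
parity-hits : ∀ d → (∀ N → ∃[ n ] N ≤ n × T (d n)) →
              ∀ s N → ∃[ n ] N ≤ n × T (d n) × parity d n ≡ s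
parity-hits d inf s N with inf N
... | n , N≤n , dn with parity d n ≟ᵇ s
...   | yes eq = n , N≤n , dn , eq
...   | no neq =
  let m , n<m , dm = inf (suc n)
      k , n<k , hit = search (≤⇒≤′ n<m) dm
  in k , ≤-trans N≤n (<⇒≤ n<k) , hit
  where
  flipped : parity d (suc n) ≡ s
  flipped with d n
  ... | true = sym (¬-not (neq ∘ sym))

  search : ∀ {m} → suc n ≤′ m → T (d m) → ∃[ k ] n < k × T (d k) × parity d k ≡ s
  search {m} n<m dm with settled n<m
    where
    settled : ∀ {m} → suc n ≤′ m → (∃[ k ] n < k × T (d k) × parity d k ≡ s) ⊎ parity d m ≡ s
    settled ≤′-refl = inj₂ flipped
    settled (≤′-step {n = m} n<m) with settled n<m | d m in eq
    ... | inj₁ hit  | _     = inj₁ hit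
    ... | inj₂ same | true  = inj₁ (m , ≤′⇒≤ n<m , subst T (sym eq) _ , same)
    ... | inj₂ same | false = inj₂ same
  ... | inj₁ hit  = hit
  ... | inj₂ same = m , ≤′⇒≤ n<m , dm , same

between* : ExcludedMiddle 0ℓ → ∀ {x y} → x ≤* y → ¬ y ≤* x →
           ∃[ z ] (x ≤* z × ¬ z ≤* x) × (z ≤* y × ¬ y ≤* z)
between* em {x} {y} x≤y y≰x =
  z , (map* (λ {n} → x≤z n) x≤y , infinite⇒≰* λ N →
        let n , N≤n , lt , eq = parity-hits d d-infinite true N
        in n , N≤n , subst (λ s → x n < (if s then y n else x n)) (sym eq) (<ᵇ⇒< (x n) (y n) lt))
    , (map* (λ {n} → z≤y n) x≤y , infinite⇒≰* λ N →
        let n , N≤n , lt , eq = parity-hits d d-infinite false N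
        in n , N≤n , subst (λ s → (if s then y n else x n) < y n) (sym eq) (<ᵇ⇒< (x n) (y n) lt))
  where
  d : ℕ → Bool
  d n = x n <ᵇ y n

  d-infinite : ∀ N → ∃[ n ] N ≤ n × T (d n)
  d-infinite N = let n , N≤n , lt = ≰*⇒infinite em y≰x N in n , N≤n , <⇒<ᵇ lt

  -- On the infinite set where `x < y`, both parities recur, so `z` equals `y` infinitely often
  -- there and `x` infinitely often: both inequalities are strict.
  z : ω^ω
  z n = if parity d n then y n else x n

  x≤z : ∀ n → x n ≤ y n → x n ≤ z n
  x≤z n le with parity d n
  ... | true  = le
  ... | false = ≤-refl

  z≤y : ∀ n → x n ≤ y n → z n ≤ y n
  z≤y n le with parity d n
  ... | true  = ≤-refl
  ... | false = le

sup≤ inf≤ : ω^ω → ω^ω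
sup≤ f zero    = f zero
sup≤ f (suc k) = sup≤ f k ⊔ f (suc k)
inf≤ f zero    = f zero
inf≤ f (suc k) = inf≤ f k ⊓ f (suc k)

≤-sup : ∀ f {i k} → i ≤′ k → f i ≤ sup≤ f k
≤-sup f {zero}  ≤′-refl = ≤-refl
≤-sup f {suc i} ≤′-refl = m≤n⊔m (sup≤ f i) (f (suc i))
≤-sup f (≤′-step {n = k} i≤k) = ≤-trans (≤-sup f i≤k) (m≤m⊔n (sup≤ f k) (f (suc k)))

inf-≤ : ∀ f {i k} → i ≤′ k → inf≤ f k ≤ f i
inf-≤ f {zero}  ≤′-refl = ≤-refl
inf-≤ f {suc i} ≤′-refl = m⊓n≤n (inf≤ f i) (f (suc i))
inf-≤ f (≤′-step {n = k} i≤k) = ≤-trans (m⊓n≤m (inf≤ f k) (f (suc k))) (inf-≤ f i≤k)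

sup-least : ∀ f k {u} → (∀ i → f i ≤ u) → sup≤ f k ≤ u
sup-least f zero    f≤ = f≤ zero
sup-least f (suc k) f≤ = ⊔-lub (sup-least f k f≤) (f≤ (suc k))

inf-greatest : ∀ f k {l} → (∀ i → i ≤ k → l ≤ f i) → l ≤ inf≤ f k
inf-greatest f zero    ≤f = ≤f zero z≤n
inf-greatest f (suc k) ≤f =
  ⊓-glb (inf-greatest f k λ i i≤k → ≤f i (m≤n⇒m≤1+n i≤k)) (≤f (suc k) ≤-refl)

-- The interpolant is x k = max_{i ≤ k} min (l_i k, u_0 k, …, u_i k): almost everywhere the i-th term
-- equals l_i, while terms with i ≥ j are below u_j outright and the others are below l_i.
squeeze* : ∀ (l u : ℕ → ω^ω) → (∀ i j → l i ≤* u j) →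
           ∃[ x ] (∀ i → l i ≤* x) × (∀ j → x ≤* u j)
squeeze* l u l≤u = x , l≤x , x≤u
  where
  term : ℕ → ω^ω
  term k i = l i k ⊓ inf≤ (λ j → u j k) i

  x : ω^ω
  x k = sup≤ (term k) k

  l≤x : ∀ i → l i ≤* x
  l≤x i = map* bound (zip* (from* i λ _ → id) (all≤* i λ j _ → l≤u i j))
    where
    bound : ∀ {k} → i ≤ k × (∀ j → j ≤ i → l i k ≤ u j k) → l i k ≤ x k
    bound {k} (i≤k , le) =
      ≤-trans (⊓-glb ≤-refl (inf-greatest (λ j → u j k) i le)) (≤-sup (term k) (≤⇒≤′ i≤k))

  x≤u : ∀ j → x ≤* u j
  x≤u j = map* bound (all≤* j λ i _ → l≤u i j)
    where
    bound : ∀ {k} → (∀ i → i ≤ j → l i k ≤ u j k) → x k ≤ u j k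
    bound {k} le = sup-least (term k) k λ i → case ≤-total i j of λ where
      (inj₁ i≤j) → ≤-trans (m⊓n≤m (l i k) _) (le i i≤j)
      (inj₂ j≤i) → ≤-trans (m⊓n≤n (l i k) _) (inf-≤ (λ j → u j k) (≤⇒≤′ j≤i))

-- The order on ω^ω∖𝟘 and the size of its maximal chains

-- Keeps interpolants outside `𝟘`: each lies above a function already outside it.
∉𝟘-upward : ∀ {x y} → x ≤* y → x ∉ 𝟘 → y ∉ 𝟘
∉𝟘-upward x≤y x∉ y≡0 = x∉ (map* (λ (le , eq) → n≤0⇒n≡0 (≤-trans le (≤-reflexive eq))) (zip* x≤y y≡0))

suc∘≰* : ∀ x → ¬ (suc ∘ x) ≤* x
suc∘≰* x = infinite⇒≰* λ N → N , ≤-refl , ≤-refl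

suc∘∉𝟘 : ∀ x → suc ∘ x ∉ 𝟘
suc∘∉𝟘 x suc≡0 = case threshold suc≡0 of λ { (N , eq) → 1+n≢0 (eq N ≤-refl) }

ω^ω∖𝟘-rich : ExcludedMiddle 0ℓ → Rich ω^ω∖𝟘
ω^ω∖𝟘-rich em = record
  { point   = suc ∘ id , suc∘∉𝟘 id
  ; above   = λ (x , _) →
      (suc ∘ x , suc∘∉𝟘 x) , ([] , λ n _ → n≤1+n (x n)) , suc∘≰* x
  ; between = λ {(x , x∉)} x≤y y≰x → case between* em x≤y y≰x of λ where
      (z , x<z , z<y) → (z , ∉𝟘-upward (proj₁ x<z) x∉) , x<z , z<y
  ; squeeze = λ l u l≤u → case squeeze* (proj₁ ∘ l) (proj₁ ∘ u) l≤u of λ where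
      (x , l≤x , x≤u) → (x , ∉𝟘-upward (l≤x 0) (proj₂ (l 0))) , l≤x , x≤u
  }

𝔠≼maximalChain : ExcludedMiddle 0ℓ → Extensionality 0ℓ 0ℓ →
                 ∀ C → IsMaximalChain ω^ω∖𝟘 C → 𝔠 ≼ ⟪_⟫ ω^ω∖𝟘 C
𝔠≼maximalChain em ext C maximal = record
  { to        = λ f → let c , c∈ , _ = limit f in c , c∈
  ; cong      = λ { refl → refl }
  ; injective = λ {f} {g} eq → ext (branches-agree {proj₁ (limit f)} f g (proj₂ (proj₂ (limit f)))
      -- Elements of `C` are compared as bare functions, so membership in the intervals of `g` is
      -- transported in terms of `≤*`.
      (λ n → subst (λ x → proj₁ (lo (branch g n)) ≤* x × x ≤* proj₁ (hi (branch g n)))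
                   (sym eq) (proj₂ (proj₂ (limit g)) n)))
  }
  where
  open Tree em ω^ω∖𝟘 (ω^ω∖𝟘-rich em) maximal
  open Interval

subset≼𝔠 : Extensionality 0ℓ 0ℓ → ∀ C → ⟪_⟫ ω^ω∖𝟘 C ≼ 𝔠
subset≼𝔠 ext C = record
  { to        = λ ((x , _) , _) → graph x
  ; cong      = cong graph
  ; injective = graph-injective ext
  }

mainTheorem2 : (∀ {ℓ} → ExcludedMiddle ℓ) →
    (∀ {a b} → Extensionality a b) →
    (∀ C → IsMaximalChain ω^ω∖𝟘 C → 𝔠 ≼ ⟪_⟫ ω^ω∖𝟘 C)
    × 𝔪𝔠≡ ω^ω∖𝟘 𝔠
mainTheorem2 em ext = lower , (C , maximal , bijection) , lower
  where
  lower : ∀ C → IsMaximalChain ω^ω∖𝟘 C → 𝔠 ≼ ⟪_⟫ ω^ω∖𝟘 C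
  lower = 𝔠≼maximalChain em ext

  open Hausdorff em ext ω^ω∖𝟘 using (hausdorff)

  C : Pred (Preorder.Carrier ω^ω∖𝟘) 0ℓ
  C = proj₁ hausdorff

  maximal : IsMaximalChain ω^ω∖𝟘 C
  maximal = proj₂ hausdorff

  open CantorBernstein em (subset≼𝔠 ext C) (lower C maximal) using (bijection)
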